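{- For every integer $l \ge 2$, the resolving total domination numbers of the fractal cubic networks satisfy $\gamma_{rt}(FCN(l)) = 4\,\gamma_{rt}(FCN(l-1))$.
   Context: Fractal cubic network: for an integer $l\ge 0$, $FCN(l)$ is the finite simple graph whose vertices are all binary strings of length $2l+2$, defined recursively as follows. $FCN(0)$ is the 4-cycle with vertices $00, 01, 11, 10$ in this cyclic order. For $l\ge 1$, $FCN(l)$ is obtained from the disjoint union of the four copies $ab\,\Vert\,FCN(l-1)$, $a,b\in\{0,1\}$ (each vertex string of $FCN(l-1)$ is prefixed by $ab$, adjacency inside a copy being that of $FCN(l-1)$), by adding the four edges $\{00w,10w\}$, $\{10w,11w\}$, $\{11w,01w\}$, $\{01w,00w\}$, where $w=10(01)^{l-1}$ is the string $10$ followed by $l-1$ repetitions of $01$. A set $R\subseteq V(\Gamma)$ of a connected graph $\Gamma$ is a resolving set if for every two distinct vertices $g,h$ there is $r\in R$ with $d(g,r)\ne d(h,r)$ (graph distance). A total dominating set is a set $D\subseteq V(\Gamma)$ such that every vertex of $\Gamma$ (including those in $D$) is adjacent to some vertex of $D$. A resolving total dominating set is a set that is both a resolving set and a total dominating set; $\gamma_{rt}(\Gamma)$ is the minimum size of such a set. -}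

module Defs where

open import Data.Bool using (Bool; true; false)
open import Data.List using (List; length)
open import Data.List.Membership.Propositional using (_∈_)
open import Data.List.Relation.Unary.Unique.Propositional using (Unique)
open import Data.Nat using (ℕ; zero; suc; _+_; _*_; _≤_)
open import Data.Product using (∃-syntax; _×_)
open import Data.Vec using (Vec; []; _∷_)
open import Level using (0ℓ)
open import Relation.Binary.Construct.Closure.Symmetric using (SymClosure; fwd; bwd; symmetric)
open import Relation.Binary.Core using (Rel)
open import Relation.Binary.Definitions using (Symmetric)
open import Relation.Binary.PropositionalEquality using (_≡_; _≢_; refl)
open import Relation.Nullary using (¬_)

record SimpleGraph : Set₁ where
  field
    Vertex : Set
    Adj    : Rel Vertex 0ℓ
    sym    : Symmetric Adj
    irrefl : ∀ {v} → ¬ Adj v v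

module _ (G : SimpleGraph) where
  open SimpleGraph G

  data Walk : Vertex → Vertex → ℕ → Set where
    stop : ∀ {u} → Walk u u 0
    step : ∀ {u v w n} → Adj u v → Walk v w n → Walk u w (suc n)

  -- The graph distance, as a relation: d(u,v) = n.
  Distance : Vertex → Vertex → ℕ → Set
  Distance u v n = Walk u v n × (∀ m → Walk u v m → n ≤ m)

  -- Requires both distances to exist, which is automatic in the connected
  -- graphs for which resolving sets are considered.
  Resolves : Vertex → Vertex → Vertex → Set
  Resolves r g h = ∃[ m ] ∃[ n ] (Distance g r m × Distance h r n × m ≢ n)

  -- Finite vertex sets are duplicate-free lists; the `Unique` condition is
  -- imposed in `IsγRT`, where cardinality matters.
  Resolving : List Vertex → Set
  Resolving R = ∀ g h → g ≢ h → ∃[ r ] (r ∈ R × Resolves r g h)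

  TotalDominating : List Vertex → Set
  TotalDominating D = ∀ v → ∃[ u ] (u ∈ D × Adj v u)

  ResolvingTotalDominating : List Vertex → Set
  ResolvingTotalDominating R = Resolving R × TotalDominating R

  -- k is the minimum cardinality of a resolving total dominating set.
  IsγRT : ℕ → Set
  IsγRT k =
    (∃[ R ] (Unique R × ResolvingTotalDominating R × length R ≡ k)) ×
    (∀ R → Unique R → ResolvingTotalDominating R → k ≤ length R)

pattern O = false
pattern I = true

-- The length is written 2 + l * 2 so that prefixing two bits to a string of
-- FCNVertex l gives an FCNVertex (suc l) definitionally.
FCNVertex : ℕ → Set
FCNVertex l = Vec Bool (2 + l * 2)

[01]^ : ∀ k → Vec Bool (k * 2)
[01]^ zero    = []
[01]^ (suc k) = O ∷ I ∷ [01]^ k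

-- The string 10(01)^l, at which four copies of FCN(l) are joined to form
-- FCN(l+1).
joint : ∀ l → FCNVertex l
joint l = I ∷ O ∷ [01]^ l

-- Each edge of FCN(l), listed in one orientation.
data FCNEdge : ∀ l → Rel (FCNVertex l) 0ℓ where
  00-01 : FCNEdge 0 (O ∷ O ∷ []) (O ∷ I ∷ [])
  01-11 : FCNEdge 0 (O ∷ I ∷ []) (I ∷ I ∷ [])
  11-10 : FCNEdge 0 (I ∷ I ∷ []) (I ∷ O ∷ [])
  10-00 : FCNEdge 0 (I ∷ O ∷ []) (O ∷ O ∷ [])
  copy  : ∀ {l u v} a b → FCNEdge l u v → FCNEdge (suc l) (a ∷ b ∷ u) (a ∷ b ∷ v)
  00w-10w : ∀ {l} → FCNEdge (suc l) (O ∷ O ∷ joint l) (I ∷ O ∷ joint l)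
  10w-11w : ∀ {l} → FCNEdge (suc l) (I ∷ O ∷ joint l) (I ∷ I ∷ joint l)
  11w-01w : ∀ {l} → FCNEdge (suc l) (I ∷ I ∷ joint l) (O ∷ I ∷ joint l)
  01w-00w : ∀ {l} → FCNEdge (suc l) (O ∷ I ∷ joint l) (O ∷ O ∷ joint l)

FCNEdge⇒≢ : ∀ {l u v} → FCNEdge l u v → u ≢ v
FCNEdge⇒≢ 00-01 ()
FCNEdge⇒≢ 01-11 ()
FCNEdge⇒≢ 11-10 ()
FCNEdge⇒≢ 10-00 ()
FCNEdge⇒≢ (copy a b e) refl = FCNEdge⇒≢ e refl
FCNEdge⇒≢ 00w-10w ()
FCNEdge⇒≢ 10w-11w ()
FCNEdge⇒≢ 11w-01w ()
FCNEdge⇒≢ 01w-00w ()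

FCN : ℕ → SimpleGraph
FCN l = record
  { Vertex = FCNVertex l
  ; Adj    = SymClosure (FCNEdge l)
  ; sym    = symmetric (FCNEdge l)
  ; irrefl = λ { (fwd e) → FCNEdge⇒≢ e refl ; (bwd e) → FCNEdge⇒≢ e refl }
  }

{-# OPTIONS --safe #-}

-- The vertices of FCN(l) are partitioned into 4^l squares p00, p01, p11, p10.
-- The vertices p00 and p11 have the same neighbours p01 and p10, so a resolving
-- set contains p00 or p11, and a set dominating p00 contains p01 or p10; hence a
-- resolving total dominating set has at least 2·4^l elements.  Conversely, the
-- 2·4^l strings ending in 0 form such a set: s1 is adjacent to exactly one of
-- them, namely s0, so adjacency alone separates any two vertices.

module Submission where

open import Defs
open import Data.Bool using (Bool; not; _xor_)
open import Data.Bool.Properties using (not-¬) renaming (_≟_ to _≟ᵇ_)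
open import Data.Fin using (Fin)
open import Data.Fin.Properties using (1↔⊤; 2↔Bool; *↔×; injective⇒≤)
open import Data.Fin.Subset.Properties using (anySubset?)
open import Data.List using (List; length; lookup; tabulate)
open import Data.List.Membership.Propositional using (_∈_)
open import Data.List.Membership.Propositional.Properties using (∈-tabulate⁺)
open import Data.List.Properties using (length-tabulate)
open import Data.List.Relation.Unary.Any using (index)
open import Data.List.Relation.Unary.Any.Properties using (lookup-index)
open import Data.List.Relation.Unary.Unique.Propositional.Properties using (tabulate⁺)
open import Data.Nat using (ℕ; zero; suc; _+_; _*_; _∸_; _^_; _≤_; z≤n; s≤s)
open import Data.Nat.Properties using (≤-antisym; *-assoc)
open import Data.Product using (∃; ∃-syntax; _×_; _,_; proj₁; proj₂; uncurry)
open import Data.Product.Function.NonDependent.Propositional using (_×-↔_)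
open import Data.Sum using (_⊎_; inj₁; inj₂; [_,_]′)
open import Data.Vec using (Vec; []; _∷_; _∷ʳ_; initLast; uncons)
open import Data.Vec.Properties using (∷ʳ-injective; ∷ʳ-injectiveˡ; ∷ʳ-injectiveʳ; ≡-dec)
open import Function using (_∘_; Injective; _↔_; mk↔ₛ′; Inverse)
open import Function.Properties.Inverse using (↔-trans)
open import Relation.Binary.Construct.Closure.ReflexiveTransitive using (Star; ε; _◅_; _◅◅_)
  renaming (gmap to Star-gmap)
open import Relation.Binary.Construct.Closure.Symmetric using (SymClosure; fwd; bwd; gmap)
open import Relation.Binary.Definitions using (Decidable; DecidableEquality)
open import Relation.Binary.PropositionalEquality
  using (_≡_; _≢_; refl; sym; trans; cong; subst; module ≡-Reasoning)
open import Relation.Nullary using (¬_; Dec; yes; no; contradiction)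
open import Relation.Nullary.Decidable using (map′; _×-dec_; _⊎-dec_)
import Relation.Unary as Unary

-- Distances, twins and resolution in an arbitrary graph.

least : ∀ {P : ℕ → Set} → Unary.Decidable P → ∀ n → P n →
  ∃[ m ] (P m × (∀ k → P k → m ≤ k))
least P? zero    p = zero , p , λ _ _ → z≤n
least {P} P? (suc n) p with P? zero
... | yes p₀ = zero , p₀ , λ _ _ → z≤n
... | no ¬p₀ with m , pm , m≤ ← least (P? ∘ suc) n p = suc m , pm , m<
  where
  m< : ∀ k → P k → suc m ≤ k
  m< zero    p₀ = contradiction p₀ ¬p₀
  m< (suc k) pk = s≤s (m≤ k pk)

module _ (G : SimpleGraph) where
  open SimpleGraph G using (Vertex; Adj)

  Star⇒Walk : ∀ {u v} → Star Adj u v → ∃ (Walk G u v)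
  Star⇒Walk ε       = zero , stop
  Star⇒Walk (e ◅ p) with n , w ← Star⇒Walk p = suc n , step e w

  -- Since `u ≢ r`, the walk has a first edge; only that edge depends on `u`, and it can be replaced
  -- by one from `u′`.
  restart-walk : ∀ {u u′ r n} → (∀ {v} → Adj u v → Adj u′ v) → u ≢ r →
    Walk G u r n → Walk G u′ r n
  restart-walk adj u≢r stop       = contradiction refl u≢r
  restart-walk adj u≢r (step e w) = step (adj e) w

  twins-unresolved : ∀ {u u′ r} →
    (∀ {v} → Adj u v → Adj u′ v) → (∀ {v} → Adj u′ v → Adj u v) →
    u ≢ r → u′ ≢ r → ¬ Resolves G r u u′
  twins-unresolved adj adj′ u≢r u′≢r (m , n , (w , m≤) , (w′ , n≤) , m≢n) =
    m≢n (≤-antisym (m≤ n (restart-walk adj′ u′≢r w′)) (n≤ m (restart-walk adj u≢r w)))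

  resolves-sym : ∀ {r g h} → Resolves G r g h → Resolves G r h g
  resolves-sym (m , n , dm , dn , m≢n) = n , m , dn , dm , m≢n ∘ sym

module Resolution (G : SimpleGraph)
  (_≟_ : DecidableEquality (SimpleGraph.Vertex G))
  (any? : ∀ {P : SimpleGraph.Vertex G → Set} → Unary.Decidable P → Dec (∃ P))
  (adj? : Decidable (SimpleGraph.Adj G))
  (connected : ∀ u v → Star (SimpleGraph.Adj G) u v)
  where

  open SimpleGraph G using (Adj)

  walk? : ∀ u v n → Dec (Walk G u v n)
  walk? u v zero    = map′ (λ { refl → stop }) (λ { stop → refl }) (u ≟ v)
  walk? u v (suc n) = map′ (λ { (_ , e , w) → step e w }) (λ { (step e w) → _ , e , w })
    (any? (λ x → adj? u x ×-dec walk? x v n))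

  -- `Resolves` asks for actual distances. A walk given by connectedness bounds the search for the
  -- least length, and each length is decided by trying all first steps.
  distance : ∀ u v → ∃ (Distance G u v)
  distance u v with n , w ← Star⇒Walk G (connected u v) = least (walk? u v) n w

  -- The hypotheses say d(g,r) ≤ k < d(h,r), so neither distance has to be computed exactly.
  resolved : ∀ {g h r} k → Walk G g r k → (∀ {j} → j ≤ k → ¬ Walk G h r j) →
    Resolves G r g h
  resolved {g} {h} {r} k w far with distance g r | distance h r
  ... | m , (wm , m≤) | n , (wn , n≤) =
    m , n , (wm , m≤) , (wn , n≤) , λ { refl → far (m≤ k w) wn }

  resolved-by-self : ∀ {g h} → g ≢ h → Resolves G g g h
  resolved-by-self g≢h = resolved 0 stop λ { z≤n stop → g≢h refl }

  resolved-by-neighbour : ∀ {g h r} → Adj g r → h ≢ r → ¬ Adj h r → Resolves G r g h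
  resolved-by-neighbour e h≢r ¬e = resolved 1 (step e stop) λ
    { z≤n stop → h≢r refl ; (s≤s z≤n) (step e′ stop) → ¬e e′ }

-- Counting by injections from bit strings.

Bits : ℕ → Set
Bits = Vec Bool

enumeration : ∀ n → Fin (2 ^ n) ↔ Bits n
enumeration zero    = ↔-trans 1↔⊤ (mk↔ₛ′ (λ _ → []) _ (λ { [] → refl }) (λ _ → refl))
enumeration (suc n) = ↔-trans *↔× (↔-trans (2↔Bool ×-↔ enumeration n)
  (mk↔ₛ′ (uncurry _∷_) uncons (λ { (_ ∷ _) → refl }) (λ _ → refl)))

bits : ∀ n → Fin (2 ^ n) → Bits n
bits n = Inverse.to (enumeration n)

bits-injective : ∀ n → Injective _≡_ _≡_ (bits n)
bits-injective n {i} {j} eq = begin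
  i            ≡⟨ strictlyInverseʳ i ⟨
  from (to i)  ≡⟨ cong from eq ⟩
  from (to j)  ≡⟨ strictlyInverseʳ j ⟩
  j            ∎
  where
  open ≡-Reasoning
  open Inverse (enumeration n)

-- The position of `f s` in `xs` determines `f s` by lookup, and hence `s`.
2^n≤length : ∀ {A : Set} {n} {f : Bits n → A} {xs : List A} →
  Injective _≡_ _≡_ f → (∀ s → f s ∈ xs) → 2 ^ n ≤ length xs
2^n≤length {n = n} {xs = xs} f-injective f∈xs =
  injective⇒≤ {f = λ i → index (f∈xs (bits n i))} λ {i} {j} eq →
    bits-injective n (f-injective (trans (lookup-index (f∈xs (bits n i)))
      (trans (cong (lookup xs) eq) (sym (lookup-index (f∈xs (bits n j)))))))

-- Adjacency in the networks: case analysis, decidability, connectedness.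

Adj : ∀ l → FCNVertex l → FCNVertex l → Set
Adj l = SymClosure (FCNEdge l)

flip₁ : ∀ a b → Adj 0 (a ∷ b ∷ []) (not a ∷ b ∷ [])
flip₁ O O = bwd 10-00
flip₁ O I = fwd 01-11
flip₁ I O = fwd 10-00
flip₁ I I = bwd 01-11

flip₂ : ∀ a b → Adj 0 (a ∷ b ∷ []) (a ∷ not b ∷ [])
flip₂ O O = fwd 00-01
flip₂ O I = bwd 00-01
flip₂ I O = bwd 11-10
flip₂ I I = fwd 11-10

-- The edges of the joining 4-cycle are oriented opposite to those of FCN 0.
join : ∀ {l a b c d} → FCNEdge 0 (c ∷ d ∷ []) (a ∷ b ∷ []) →
  FCNEdge (suc l) (a ∷ b ∷ joint l) (c ∷ d ∷ joint l)
join 00-01 = 01w-00w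
join 01-11 = 11w-01w
join 11-10 = 10w-11w
join 10-00 = 00w-10w

edge-cases : ∀ {l a b c d u v} → FCNEdge (suc l) (a ∷ b ∷ u) (c ∷ d ∷ v) →
  ((a ≡ c × b ≡ d) × FCNEdge l u v) ⊎
  (FCNEdge 0 (c ∷ d ∷ []) (a ∷ b ∷ []) × u ≡ joint l × v ≡ joint l)
edge-cases (copy a b e) = inj₁ ((refl , refl) , e)
edge-cases 00w-10w      = inj₂ (10-00 , refl , refl)
edge-cases 10w-11w      = inj₂ (11-10 , refl , refl)
edge-cases 11w-01w      = inj₂ (01-11 , refl , refl)
edge-cases 01w-00w      = inj₂ (00-01 , refl , refl)

adj-cases : ∀ {l a b c d u v} → Adj (suc l) (a ∷ b ∷ u) (c ∷ d ∷ v) →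
  ((a ≡ c × b ≡ d) × Adj l u v) ⊎ (u ≡ joint l × v ≡ joint l)
adj-cases (fwd e) with edge-cases e
... | inj₁ (ab≡cd , e′)    = inj₁ (ab≡cd , fwd e′)
... | inj₂ (_ , u≡ , v≡)   = inj₂ (u≡ , v≡)
adj-cases (bwd e) with edge-cases e
... | inj₁ ((refl , refl) , e′) = inj₁ ((refl , refl) , bwd e′)
... | inj₂ (_ , v≡ , u≡)        = inj₂ (u≡ , v≡)

_≟_ : ∀ {n} → DecidableEquality (Bits n)
_≟_ = ≡-dec _≟ᵇ_

-- The listed edges orient the 4-cycle, so each vertex has exactly one outgoing edge; its target has
-- this closed form, which reduces `edge?` at level 0 to two bit comparisons.
rotate : ∀ a b → FCNEdge 0 (a ∷ b ∷ []) (b ∷ not a ∷ [])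
rotate O O = 00-01
rotate O I = 01-11
rotate I I = 11-10
rotate I O = 10-00

edge? : ∀ l → Decidable (FCNEdge l)
edge? zero (a ∷ b ∷ []) (c ∷ d ∷ []) = map′
  (λ { (refl , refl) → rotate a b }) unrotate ((c ≟ᵇ b) ×-dec (d ≟ᵇ not a))
  where
  unrotate : FCNEdge 0 (a ∷ b ∷ []) (c ∷ d ∷ []) → c ≡ b × d ≡ not a
  unrotate 00-01 = refl , refl
  unrotate 01-11 = refl , refl
  unrotate 11-10 = refl , refl
  unrotate 10-00 = refl , refl
edge? (suc l) (a ∷ b ∷ u) (c ∷ d ∷ v) =
  map′ [ (λ { ((refl , refl) , e) → copy a b e }) , (λ { (e , refl , refl) → join e }) ]′
    edge-cases
    ((((a ≟ᵇ c) ×-dec (b ≟ᵇ d)) ×-dec edge? l u v) ⊎-dec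
     (edge? 0 (c ∷ d ∷ []) (a ∷ b ∷ []) ×-dec (u ≟ joint l) ×-dec (v ≟ joint l)))

adj? : ∀ l → Decidable (Adj l)
adj? l u v = map′ [ fwd , bwd ]′ (λ { (fwd e) → inj₁ e ; (bwd e) → inj₂ e })
  (edge? l u v ⊎-dec edge? l v u)

connected₀ : ∀ u v → Star (Adj 0) u v
connected₀ (a ∷ b ∷ []) (c ∷ d ∷ []) = move₁ a c ◅◅ move₂ b d
  where
  move₁ : ∀ a c → Star (Adj 0) (a ∷ b ∷ []) (c ∷ b ∷ [])
  move₁ O O = ε
  move₁ O I = flip₁ O b ◅ ε
  move₁ I O = flip₁ I b ◅ ε
  move₁ I I = ε
  move₂ : ∀ b d → Star (Adj 0) (c ∷ b ∷ []) (c ∷ d ∷ [])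
  move₂ O O = ε
  move₂ O I = flip₂ c O ◅ ε
  move₂ I O = flip₂ c I ◅ ε
  move₂ I I = ε

connected : ∀ l u v → Star (Adj l) u v
connected zero    u v = connected₀ u v
connected (suc l) (a ∷ b ∷ u) (c ∷ d ∷ v) =
  -- Go to the joint of the first copy, around the joining 4-cycle, then from the joint of the
  -- second copy to the target.
  within a b u (joint l) ◅◅
  Star-gmap at-joint joining (connected₀ (a ∷ b ∷ []) (c ∷ d ∷ [])) ◅◅
  within c d (joint l) v
  where
  within : ∀ a b u v → Star (Adj (suc l)) (a ∷ b ∷ u) (a ∷ b ∷ v)
  within a b u v = Star-gmap _ (gmap _ (copy a b)) (connected l u v)
  at-joint : FCNVertex 0 → FCNVertex (suc l)
  at-joint (a ∷ b ∷ []) = a ∷ b ∷ joint l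
  joining : ∀ {x y} → Adj 0 x y → Adj (suc l) (at-joint x) (at-joint y)
  joining {_ ∷ _ ∷ []} {_ ∷ _ ∷ []} (fwd e) = bwd (join e)
  joining {_ ∷ _ ∷ []} {_ ∷ _ ∷ []} (bwd e) = fwd (join e)

-- The innermost squares, given by the last two bits.

∷ʳO≢∷ʳI : ∀ {n} (s t : Bits n) → s ∷ʳ O ≢ t ∷ʳ I
∷ʳO≢∷ʳI s t eq = contradiction (∷ʳ-injectiveʳ s t eq) λ ()

square₁ : ∀ l (p : Bits (l * 2)) z y → Adj l (p ∷ʳ z ∷ʳ y) (p ∷ʳ not z ∷ʳ y)
square₁ zero    []          z y = flip₁ z y
square₁ (suc l) (a ∷ b ∷ p) z y = gmap _ (copy a b) (square₁ l p z y)

square₂ : ∀ l (p : Bits (l * 2)) z y → Adj l (p ∷ʳ z ∷ʳ y) (p ∷ʳ z ∷ʳ not y)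
square₂ zero    []          z y = flip₂ z y
square₂ (suc l) (a ∷ b ∷ p) z y = gmap _ (copy a b) (square₂ l p z y)

diagonal-adj : ∀ l (p : Bits (l * 2)) x z → Adj l (p ∷ʳ x ∷ʳ x) (p ∷ʳ z ∷ʳ not z)
diagonal-adj l p O O = square₂ l p O O
diagonal-adj l p O I = square₁ l p O O
diagonal-adj l p I O = square₁ l p I I
diagonal-adj l p I I = square₂ l p I I

[01]^-suc : ∀ k → ∃[ p ] [01]^ (suc k) ≡ p ∷ʳ O ∷ʳ I
[01]^-suc zero    = [] , refl
[01]^-suc (suc k) with p , eq ← [01]^-suc k = O ∷ I ∷ p , cong (λ s → O ∷ I ∷ s) eq

-- The joint ends in 10 at level 0 and in 01 above it. Joining edges therefore meet only the corners
-- p01 and p10 of a square, and p00 and p11 remain twins at every level.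
joint-antidiagonal : ∀ l → ∃[ p ] ∃[ z ] joint l ≡ p ∷ʳ z ∷ʳ not z
joint-antidiagonal zero    = [] , I , refl
joint-antidiagonal (suc l) with p , eq ← [01]^-suc l =
  I ∷ O ∷ p , O , cong (λ s → I ∷ O ∷ s) eq

diagonal≢joint : ∀ l (p : Bits (l * 2)) x → p ∷ʳ x ∷ʳ x ≢ joint l
diagonal≢joint l p x eq
  with q , z , eq′ ← joint-antidiagonal l
  with p∷x≡q∷z , x≡¬z ← ∷ʳ-injective (p ∷ʳ x) (q ∷ʳ z) (trans eq eq′)
  = not-¬ (∷ʳ-injectiveʳ p q p∷x≡q∷z) x≡¬z

diagonal-neighbour : ∀ l (p : Bits (l * 2)) x {v} → Adj l (p ∷ʳ x ∷ʳ x) v →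
  ∃[ z ] v ≡ p ∷ʳ z ∷ʳ not z
diagonal-neighbour zero [] O (fwd 00-01) = O , refl
diagonal-neighbour zero [] O (bwd 10-00) = I , refl
diagonal-neighbour zero [] I (fwd 11-10) = I , refl
diagonal-neighbour zero [] I (bwd 01-11) = O , refl
diagonal-neighbour (suc l) (a ∷ b ∷ p) x {c ∷ d ∷ v} e with adj-cases e
... | inj₂ (≡joint , _)       = contradiction ≡joint (diagonal≢joint l p x)
... | inj₁ ((refl , refl) , e′) with z , refl ← diagonal-neighbour l p x e′ = z , refl

diagonal-twins : ∀ l (p : Bits (l * 2)) x y {v} →
  Adj l (p ∷ʳ x ∷ʳ x) v → Adj l (p ∷ʳ y ∷ʳ y) v
diagonal-twins l p x y e with z , refl ← diagonal-neighbour l p x e = diagonal-adj l p y z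

-- A joining edge preserves the last bit. An edge that changes it thus comes from a copy of the
-- 4-cycle, where every edge flips a single bit.
∷ʳI-neighbour : ∀ l (s t : Bits (1 + l * 2)) → Adj l (s ∷ʳ I) (t ∷ʳ O) → s ≡ t
∷ʳI-neighbour zero (O ∷ []) (.O ∷ []) (bwd 00-01) = refl
∷ʳI-neighbour zero (I ∷ []) (.I ∷ []) (fwd 11-10) = refl
∷ʳI-neighbour (suc l) (a ∷ b ∷ s) (c ∷ d ∷ t) e with adj-cases e
... | inj₁ ((refl , refl) , e′) = cong (λ u → a ∷ b ∷ u) (∷ʳI-neighbour l s t e′)
... | inj₂ (s≡ , t≡)            = contradiction (trans t≡ (sym s≡)) (∷ʳO≢∷ʳI t s)

-- A `Subset` is a vector of booleans, so deciding over all subsets is an exhaustive search over the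
-- vertices.
module FCN-Resolution l = Resolution (FCN l) _≟_ anySubset? (adj? l) (connected l)
open FCN-Resolution using (resolved-by-self; resolved-by-neighbour)

-- The upper bound: strings ending in 0.

γ : ℕ → ℕ
γ l = 2 ^ (1 + l * 2)

code : ∀ l → Fin (γ l) → FCNVertex l
code l i = bits (1 + l * 2) i ∷ʳ O

code-injective : ∀ l → Injective _≡_ _≡_ (code l)
code-injective l eq = bits-injective (1 + l * 2) (∷ʳ-injectiveˡ _ _ eq)

ending-in-O : ∀ l → List (FCNVertex l)
ending-in-O l = tabulate (code l)

∷ʳO∈ending-in-O : ∀ l s → s ∷ʳ O ∈ ending-in-O l
∷ʳO∈ending-in-O l s =
  subst (λ t → t ∷ʳ O ∈ ending-in-O l) (strictlyInverseˡ s) (∈-tabulate⁺ (from s))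
  where open Inverse (enumeration (1 + l * 2))

ending-in-O-resolving : ∀ l → Resolving (FCN l) (ending-in-O l)
ending-in-O-resolving l g h g≢h with initLast g | initLast h
... | s , O , refl | _ =
  s ∷ʳ O , ∷ʳO∈ending-in-O l s ,
  resolved-by-self l g≢h
... | s , I , refl | t , O , refl =
  t ∷ʳ O , ∷ʳO∈ending-in-O l t , resolves-sym (FCN l)
    (resolved-by-self l (g≢h ∘ sym))
... | s , I , refl | t , I , refl =
  s ∷ʳ O , ∷ʳO∈ending-in-O l s ,
  resolved-by-neighbour l s∷ʳI~s∷ʳO
    (∷ʳO≢∷ʳI s t ∘ sym) (λ e → g≢h (cong (_∷ʳ I) (sym (∷ʳI-neighbour l t s e))))
  where
  s∷ʳI~s∷ʳO : Adj l (s ∷ʳ I) (s ∷ʳ O)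
  s∷ʳI~s∷ʳO with p , z , refl ← initLast s = square₂ l p z I

ending-in-O-dominating : ∀ l → TotalDominating (FCN l) (ending-in-O l)
ending-in-O-dominating l v with s , y , refl ← initLast v with p , z , refl ← initLast s | y
... | O = p ∷ʳ not z ∷ʳ O , ∷ʳO∈ending-in-O l _ , square₁ l p z O
... | I = p ∷ʳ z ∷ʳ O , ∷ʳO∈ending-in-O l _ , square₂ l p z I

-- The lower bound: two elements of the set in every square.

xor-cancelʳ : ∀ x y z → x xor z ≡ y xor z → x ≡ y
xor-cancelʳ O O z _  = refl
xor-cancelʳ O I z eq = contradiction eq (not-¬ refl)
xor-cancelʳ I O z eq = contradiction (sym eq) (not-¬ refl)
xor-cancelʳ I I z _  = refl

module LowerBound l {R : List (FCNVertex l)} (rtd : ResolvingTotalDominating (FCN l) R) where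

  diagonal∈R : ∀ p → ∃[ z ] p ∷ʳ z ∷ʳ z ∈ R
  diagonal∈R p with r , r∈R , res ← proj₁ rtd (p ∷ʳ O ∷ʳ O) (p ∷ʳ I ∷ʳ I) (∷ʳO≢∷ʳI _ _)
               with (p ∷ʳ O ∷ʳ O) ≟ r | (p ∷ʳ I ∷ʳ I) ≟ r
  ... | yes refl | _        = O , r∈R
  ... | no _     | yes refl = I , r∈R
  ... | no ≢r    | no ≢r′   = contradiction res
    (twins-unresolved (FCN l) (diagonal-twins l p O I) (diagonal-twins l p I O) ≢r ≢r′)

  antidiagonal∈R : ∀ p → ∃[ z ] p ∷ʳ z ∷ʳ not z ∈ R
  antidiagonal∈R p with u , u∈R , e ← proj₂ rtd (p ∷ʳ O ∷ʳ O)
                   with z , refl ← diagonal-neighbour l p O e = z , u∈R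

  pick : ∀ y p → ∃[ z ] p ∷ʳ z ∷ʳ (y xor z) ∈ R
  pick O = diagonal∈R
  pick I = antidiagonal∈R

  -- The bit `y` selects a diagonal of the square `p`, and `z` the corner of it found in `R`. As `y`
  -- is the xor of the last two bits, the vertex determines both `y` and `p`.
  chosen : Bits (1 + l * 2) → FCNVertex l
  chosen (y ∷ p) = let z , _ = pick y p in p ∷ʳ z ∷ʳ (y xor z)

  chosen∈R : ∀ s → chosen s ∈ R
  chosen∈R (y ∷ p) = proj₂ (pick y p)

  chosen-injective : Injective _≡_ _≡_ chosen
  chosen-injective {y ∷ p} {y′ ∷ p′} eq
    -- Abstracting the picks makes `z` and `z′` variables, which matching on `refl` can then
    -- identify.
    with pick y p | pick y′ p′
  ... | z , _ | z′ , _
    with init≡ , last≡ ← ∷ʳ-injective (p ∷ʳ z) (p′ ∷ʳ z′) eq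
    with refl , refl ← ∷ʳ-injective p p′ init≡
    = cong (_∷ p) (xor-cancelʳ y y′ z last≡)

  γ≤length : γ l ≤ length R
  γ≤length = 2^n≤length chosen-injective chosen∈R

isγRT : ∀ l → IsγRT (FCN l) (γ l)
isγRT l =
  (ending-in-O l , tabulate⁺ (code-injective l) ,
    (ending-in-O-resolving l , ending-in-O-dominating l) , length-tabulate (code l)) ,
  λ R _ rtd → LowerBound.γ≤length l rtd

theorem29 : ∀ (l : ℕ) → 2 ≤ l →
    ∃[ m ] ∃[ n ] (IsγRT (FCN (l ∸ 1)) m × IsγRT (FCN l) n × n ≡ 4 * m)
-- Two further bits: `γ (suc l)` unfolds to `2 * (2 * γ l)`.
theorem29 (suc l) _ = γ l , γ (suc l) , isγRT l , isγRT (suc l) , sym (*-assoc 2 2 (γ l))
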